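{- Let $k$ be a positive integer and let $\mathcal{A}$ be a monotone family of subsets of $[n]$ with all minterms of size at most $k$. Then the function $p \mapsto \frac{\mu(\mathcal{A},p)}{p^k}$ is monotone decreasing (in the weak sense, i.e. non-increasing). Consequently, for $\mathcal{A}$ non-trivial and $0<\epsilon<1$, $$\delta_\epsilon(\mathcal{A})\ge 1-(2\epsilon)^{1/k}.$$
   Context: Let $[n]=\{0,1,\ldots,n\}$. For $p\in[0,1]$, $[n]_p$ denotes a random subset of $[n]$ in which each element is included independently with probability $p$. For a family $\mathcal{A}$ of subsets of $[n]$, $\mu(\mathcal{A},p)=\Pr([n]_p\in\mathcal{A})$. A family $\mathcal{A}$ is monotone if $A\in\mathcal{A}$ and $A\subset B\subseteq [n]$ imply $B\in\mathcal{A}$. A minterm of $\mathcal{A}$ is a member of $\mathcal{A}$ that is minimal with respect to inclusion. A monotone family is non-trivial if it is neither empty nor the whole power set of $[n]$. For a non-trivial monotone family $\mathcal{A}$ and $x\in[0,1]$, $p_x$ is the unique number in $[0,1]$ with $\mu(\mathcal{A},p_x)=x$. For $0<\epsilon<1$ define $\delta_\epsilon(\mathcal{A})=\frac{p_{1/2}-p_\epsilon}{p_{1/2}}$.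
   Formalization: The bound on δ_ε is proved for 0<ε≤1/2 instead of 0<ε<1; for ε>1/2 it is false in general (k=2, 𝒜={S : 0∈S}, ε=3/4: δ_ε=-1/2 but 1-(3/2)^{1/2}≈-0.22). Membership in 𝒜 is taken to be decidable, which is automatic classically. -}

module Defs where

open import Algebra.Apartness.Bundles using (HeytingField)
open import Algebra.Bundles using (CommutativeRing)
import Algebra.Apartness.Properties.HeytingCommutativeRing as HeytingProperties
import Algebra.Properties.Ring as RingProperties
import Algebra.Properties.Semiring.Exp as Exp
import Algebra.Properties.Semiring.Mult as Mult
open import Data.Fin.Subset using (Subset; inside; outside; _⊆_)
open import Data.List.Base using (List; []; _∷_; _++_; map; filter; foldr)
open import Data.Nat.Base as ℕ using (ℕ; zero; suc)
open import Data.Product.Base using (∃-syntax; _×_; _,_; proj₁)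
open import Data.Sum.Base using (_⊎_; inj₁; inj₂)
open import Data.Vec.Base as Vec using ()
open import Function.Bundles using (_⇔_; Equivalence)
open import Level using (Level; _⊔_) renaming (suc to lsuc)
open import Relation.Binary.Core using (Rel)
open import Relation.Binary.PropositionalEquality.Core using (_≡_)
open import Relation.Binary.Structures using (IsStrictPartialOrder)
open import Relation.Nullary.Negation using (¬_)
open import Relation.Unary using (Pred; Decidable; Empty; Universal)

private variable
  a : Level
  n : ℕ

Family : ∀ ℓ → ℕ → Set (lsuc ℓ)
Family ℓ n = Pred (Subset n) ℓ

Monotone : Family a n → Set a
Monotone 𝒜 = ∀ {S T} → 𝒜 S → S ⊆ T → 𝒜 T

IsMinterm : Family a n → Pred (Subset n) a
IsMinterm 𝒜 M = 𝒜 M × (∀ {S} → 𝒜 S → S ⊆ M → S ≡ M)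

NonTrivial : Family a n → Set a
NonTrivial 𝒜 = ¬ Empty 𝒜 × ¬ Universal 𝒜

subsets : ∀ n → List (Subset n)
subsets zero    = Vec.[] ∷ []
subsets (suc n) = map (outside Vec.∷_) (subsets n) ++ map (inside Vec.∷_) (subsets n)

-- An axiomatisation of ℝ: a Cauchy-complete Archimedean ordered field.
-- Classically this determines ℝ up to unique isomorphism.  Excluded middle is
-- not assumed: x ≤ y means ¬ (y < x), and x # y means x < y or y < x.

record RealNumbers c ℓ₁ ℓ₂ ℓ₃ : Set (lsuc (c ⊔ ℓ₁ ⊔ ℓ₂ ⊔ ℓ₃)) where
  field
    heytingField : HeytingField c ℓ₁ ℓ₂

  open HeytingField heytingField public

  commutativeRing : CommutativeRing c ℓ₁
  commutativeRing = record { isCommutativeRing = isCommutativeRing }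

  open CommutativeRing commutativeRing public using (ring; semiring)
  open Exp semiring public using (_^_)
  open Mult semiring using () renaming (_×_ to _·_)

  infix 4 _<_ _≤_
  field
    _<_                  : Rel Carrier ℓ₃
    isStrictPartialOrder : IsStrictPartialOrder _≈_ _<_
    #⇔<⊎>                : ∀ {x y} → x # y ⇔ (x < y ⊎ y < x)
    +-monoˡ-<            : ∀ {x y} z → x < y → x + z < y + z
    *-pos                : ∀ {x y} → 0# < x → 0# < y → 0# < x * y
    archimedean          : ∀ x → ∃[ m ] x < m · 1#

  _≤_ : Rel Carrier ℓ₃
  x ≤ y = ¬ (y < x)

  IsCauchy : (ℕ → Carrier) → Set (c ⊔ ℓ₃)
  IsCauchy s = ∀ e → 0# < e → ∃[ N ] (∀ i j → N ℕ.≤ i → N ℕ.≤ j → s i < s j + e)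

  _ConvergesTo_ : (ℕ → Carrier) → Carrier → Set (c ⊔ ℓ₃)
  s ConvergesTo l =
    ∀ e → 0# < e → ∃[ N ] (∀ i → N ℕ.≤ i → (s i < l + e) × (l < s i + e))

  field
    complete : ∀ s → IsCauchy s → ∃[ l ] s ConvergesTo l

  open IsStrictPartialOrder isStrictPartialOrder public
    using (<-respʳ-≈; <-respˡ-≈)
    renaming (irrefl to <-irrefl; trans to <-trans; asym to <-asym)

module RealDefinitions {c ℓ₁ ℓ₂ ℓ₃} (ℝ : RealNumbers c ℓ₁ ℓ₂ ℓ₃) where

  open RealNumbers ℝ public
  open HeytingProperties (HeytingField.heytingCommutativeRing heytingField) public
    using (1#0; x#0y#0→xy#0)
  open RingProperties ring using (-1*x≈-x; -‿involutive)

  infixl 7 _/_⟨_⟩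

  -- #⇒invertible inverts the difference y - 0# rather than y itself.
  _/_⟨_⟩ : Carrier → (y : Carrier) → y # 0# → Carrier
  x / y ⟨ y#0 ⟩ = x * proj₁ (#⇒invertible y#0)

  ^-#0 : ∀ {x} k → x # 0# → x ^ k # 0#
  ^-#0 zero    x#0 = 1#0
  ^-#0 (suc k) x#0 = x#0y#0→xy#0 x#0 (^-#0 k x#0)

  0<1 : 0# < 1#
  0<1 with Equivalence.to #⇔<⊎> 1#0
  ... | inj₂ 0<1 = 0<1
  ... | inj₁ 1<0 = <-respʳ-≈ [-1]²≈1 (*-pos 0<-1 0<-1)
    where
    0<-1 : 0# < - 1#
    0<-1 = <-respʳ-≈ (+-identityˡ _) (<-respˡ-≈ (-‿inverseʳ 1#) (+-monoˡ-< (- 1#) 1<0))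
    [-1]²≈1 : - 1# * - 1# ≈ 1#
    [-1]²≈1 = trans (-1*x≈-x (- 1#)) (-‿involutive 1#)

  2# : Carrier
  2# = 1# + 1#

  2#0 : 2# # 0#
  2#0 = Equivalence.from #⇔<⊎>
    (inj₂ (<-trans 0<1 (<-respˡ-≈ (+-identityˡ 1#) (+-monoˡ-< 1# 0<1))))

  ½ : Carrier
  ½ = 1# / 2# ⟨ 2#0 ⟩

  infix 4 _∈[0,1]
  _∈[0,1] : Carrier → Set ℓ₃
  p ∈[0,1] = 0# ≤ p × p ≤ 1#

  -- Probability that the p-random subset equals S, by independence of the elements.
  weight : Carrier → Subset n → Carrier
  weight p Vec.[]              = 1#
  weight p (inside  Vec.∷ S) = p * weight p S
  weight p (outside Vec.∷ S) = (1# - p) * weight p S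

  sum : List Carrier → Carrier
  sum = foldr _+_ 0#

  μ : {𝒜 : Family a n} → Decidable 𝒜 → Carrier → Carrier
  μ 𝒜? p = sum (map (weight p) (filter 𝒜? (subsets _)))

  -- "p is p_x": for non-trivial monotone families such a p is unique.
  IsCritical : {𝒜 : Family a n} → Decidable 𝒜 → Carrier → Carrier → Set (ℓ₁ ⊔ ℓ₃)
  IsCritical 𝒜? x p = p ∈[0,1] × μ 𝒜? p ≈ x

  -- "r is x^(1/k)", for k ≥ 1 and x ≥ 0.
  IsRoot : ℕ → Carrier → Carrier → Set (ℓ₁ ⊔ ℓ₃)
  IsRoot k x r = 0# ≤ r × r ^ k ≈ x

  -- δ_ε as a function of p_{1/2} and p_ε.
  δ : (p½ pε : Carrier) → p½ # 0# → Carrier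
  δ p½ pε p½#0 = (p½ - pε) / p½ ⟨ p½#0 ⟩

{-# OPTIONS --safe #-}
-- Write p = t q with t ∈ [0,1].  If S and T are independent q- and t-random
-- subsets, then S ∩ T is a (t q)-random subset.  A member S of 𝒜 contains a
-- minterm of size at most k, which survives the intersection with T with
-- probability at least t ^ k.  Hence t ^ k * μ(q) ≤ μ(t q), which is the
-- monotonicity of μ(p) / p ^ k.
--
-- Applied to p_ε ≤ p_½ this gives p_ε ^ k ≤ 2 ε p_½ ^ k, hence the bound on δ.
-- That p_ε ≤ p_½ also follows from the coupling: T is empty with
-- probability (1 - t) ^ n on n points and a non-trivial 𝒜 does not contain ∅, so
-- μ(t q) ≤ (1 - (1 - t) ^ n) * μ(q), which is less than μ(q) if t < 1 and μ(q) > 0.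
module Submission where

open import Defs
import Algebra.Properties.CommutativeSemigroup as CommutativeSemigroupProperties
import Algebra.Properties.CommutativeSemiring.Exp as CommutativeSemiringExp
import Algebra.Properties.Ring as RingProperties
import Algebra.Properties.Semiring.Exp as SemiringExp
open import Algebra.Apartness.Bundles using (HeytingField)
import Algebra.Apartness.Properties.HeytingCommutativeRing as HeytingProperties
open import Algebra.Bundles using (CommutativeRing)
open import Data.Bool.Base using (true; false; if_then_else_)
open import Data.Fin.Subset using (Subset; inside; outside; _⊆_; _⊂_; _∩_; ⊥; ∣_∣)
open import Data.Fin.Subset.Induction using (⊂-wellFounded)
open import Data.Fin.Subset.Properties
  using (_∈?_; _⊂?_; anySubset?; out⊆; p∩q⊆p; p∩q⊆q; s⊆s; x∈p∩q⁺;
         ⊆-antisym; ⊆-min; ⊆-refl; ⊆-trans)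
open import Data.List.Base using ([]; _∷_; _++_; map; filter)
open import Data.List.Properties using (map-++; map-∘)
open import Data.Nat.Base as ℕ using (ℕ; zero; suc; NonZero; z≤n; s≤s)
open import Data.Product.Base using (Σ-syntax; ∃-syntax; _×_; _,_; proj₁)
open import Data.Sum.Base using (_⊎_; inj₁; inj₂)
open import Data.Vec.Base as Vec using ()
open import Function.Base using (_∘_)
open import Function.Bundles using (Equivalence)
open import Induction.WellFounded using (Acc; acc)
open import Level using (Level)
open import Relation.Binary.Definitions using (Trans)
open import Relation.Binary.PropositionalEquality.Core as ≡ using (_≡_)
import Relation.Binary.Reasoning.Base.Triple as TripleReasoning
import Relation.Binary.Reasoning.Setoid as SetoidReasoning
open import Relation.Binary.Structures using (IsPreorder; IsStrictPartialOrder)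
open import Relation.Nullary.Decidable.Core using (yes; no; does; _×-dec_)
open import Relation.Nullary.Negation using (¬_; contradiction)
open import Relation.Unary using (Decidable)

private variable
  a : Level
  n : ℕ

-- Minterms inside members of a decidable family.

¬⊂⇒≡ : {S T : Subset n} → S ⊆ T → ¬ (S ⊂ T) → S ≡ T
¬⊂⇒≡ {S = S} {T} S⊆T S⊄T = ⊆-antisym S⊆T T⊆S
  where
  T⊆S : T ⊆ S
  T⊆S {x} x∈T with x ∈? S
  ... | yes x∈S = x∈S
  ... | no  x∉S = contradiction ((λ {y} → S⊆T {y}) , x , x∈T , x∉S) S⊄T

-- Well-founded descent along `⊂`. Decidability of `𝒜` makes the search for a smaller member a
-- finite one; when it fails, the current set is itself a minterm.
minterm-below : {𝒜 : Family a n} → Decidable 𝒜 → ∀ S → 𝒜 S → ∃[ M ] IsMinterm 𝒜 M × M ⊆ S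
minterm-below {𝒜 = 𝒜} 𝒜? S = go (⊂-wellFounded S)
  where
  go : ∀ {S} → Acc _⊂_ S → 𝒜 S → ∃[ M ] IsMinterm 𝒜 M × M ⊆ S
  go {S} (acc below) S∈𝒜 with anySubset? (λ T → (T ⊂? S) ×-dec 𝒜? T)
  ... | no  ∄T = S , (S∈𝒜 , λ T∈𝒜 T⊆S → ¬⊂⇒≡ T⊆S λ T⊂S → ∄T (_ , T⊂S , T∈𝒜)) , ⊆-refl
  ... | yes (T , T⊂S , T∈𝒜) with go (below T⊂S) T∈𝒜
  ... | M , minM , M⊆T = M , minM , ⊆-trans M⊆T (proj₁ T⊂S)

-- Constructive ordered-field arithmetic, with `≤` as a negated `<`.

module OrderedField {c ℓ₁ ℓ₂ ℓ₃} (ℝ : RealNumbers c ℓ₁ ℓ₂ ℓ₃) where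

  open RealDefinitions ℝ
  open CommutativeRing commutativeRing using (commutativeSemiring)
  open CommutativeSemigroupProperties (CommutativeRing.*-commutativeSemigroup commutativeRing) public
    using (x∙yz≈y∙xz; xy∙z≈xz∙y)
  open CommutativeSemigroupProperties (CommutativeRing.+-commutativeSemigroup commutativeRing) public
    using (interchange)
  open CommutativeSemiringExp commutativeSemiring public using (^-distrib-*)
  open SemiringExp semiring public using (^-congˡ)
  open RingProperties ring public
    using (-‿distribˡ-*; //-rightDividesˡ; //-rightDividesʳ)
  open HeytingProperties (HeytingField.heytingCommutativeRing heytingField) public
    using (x-0≈x; invertibleʳ⇒#)

  private variable
    x y z u v p q : Carrier

  -- Cotransitivity of apartness, carried over to the order. It stands in for trichotomy and allows
  -- `<` and `≤` to be chained without excluded middle.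
  <-cotrans : x < y → ∀ z → x < z ⊎ z < y
  <-cotrans x<y z with #-cotrans (Equivalence.from #⇔<⊎> (inj₁ x<y)) z
  ... | inj₁ x#z with Equivalence.to #⇔<⊎> x#z
  ...   | inj₁ x<z = inj₁ x<z
  ...   | inj₂ z<x = inj₂ (<-trans z<x x<y)
  <-cotrans x<y z | inj₂ z#y with Equivalence.to #⇔<⊎> z#y
  ...   | inj₁ z<y = inj₂ z<y
  ...   | inj₂ y<z = inj₁ (<-trans x<y y<z)

  <⇒≤ : x < y → x ≤ y
  <⇒≤ = <-asym

  ≈⇒≤ : x ≈ y → x ≤ y
  ≈⇒≤ x≈y = <-irrefl (sym x≈y)

  ≤-refl : x ≤ x
  ≤-refl = ≈⇒≤ refl

  <-≤-trans : Trans _<_ _≤_ _<_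
  <-≤-trans {k = z} x<y y≤z with <-cotrans x<y z
  ... | inj₁ x<z = x<z
  ... | inj₂ z<y = contradiction z<y y≤z

  ≤-<-trans : Trans _≤_ _<_ _<_
  ≤-<-trans {i = x} x≤y y<z with <-cotrans y<z x
  ... | inj₁ y<x = contradiction y<x x≤y
  ... | inj₂ x<z = x<z

  ≤-trans : x ≤ y → y ≤ z → x ≤ z
  ≤-trans x≤y y≤z z<x = y≤z (<-≤-trans z<x x≤y)

  ≤-isPreorder : IsPreorder _≈_ _≤_
  ≤-isPreorder = record { isEquivalence = isEquivalence ; reflexive = ≈⇒≤ ; trans = ≤-trans }

  module ≤-Reasoning = TripleReasoning ≤-isPreorder <-asym <-trans
    (IsStrictPartialOrder.<-resp-≈ isStrictPartialOrder) <⇒≤ <-≤-trans ≤-<-trans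
    using (begin_; begin-strict_; step-≈-⟩; step-≈-⟨; step-≤; step-<; _∎;
           begin-equality_; step-≡-⟩; step-≡-⟨)

  open ≤-Reasoning

  -- Refuting both strict inequalities refutes apartness, and apartness is tight.
  ≤∧≮⇒≈ : x ≤ y → ¬ (x < y) → x ≈ y
  ≤∧≮⇒≈ {x} {y} x≤y x≮y = proj₁ (tight x y) (neither ∘ Equivalence.to #⇔<⊎>)
    where
    neither : ¬ (x < y ⊎ y < x)
    neither (inj₁ x<y) = x≮y x<y
    neither (inj₂ y<x) = x≤y y<x

  ≤∧#⇒< : x ≤ y → y # x → x < y
  ≤∧#⇒< x≤y y#x with Equivalence.to #⇔<⊎> y#x
  ... | inj₁ y<x = contradiction y<x x≤y
  ... | inj₂ x<y = x<y

  +-cancelʳ-< : ∀ z → x + z < y + z → x < y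
  +-cancelʳ-< {x} {y} z lt = begin-strict
    x            ≈⟨ //-rightDividesʳ z x ⟨
    x + z - z    <⟨ +-monoˡ-< (- z) lt ⟩
    y + z - z    ≈⟨ //-rightDividesʳ z y ⟩
    y            ∎

  -- Contraposition turns strict cancellation into weak monotonicity, and strict monotonicity into
  -- weak cancellation; `*-cancelʳ-≤` follows the latter pattern.
  +-monoˡ-≤ : ∀ z → x ≤ y → x + z ≤ y + z
  +-monoˡ-≤ z x≤y lt = x≤y (+-cancelʳ-< z lt)

  +-cancelʳ-≤ : ∀ z → x + z ≤ y + z → x ≤ y
  +-cancelʳ-≤ z le y<x = le (+-monoˡ-< z y<x)

  +-monoʳ-≤ : ∀ z → x ≤ y → z + x ≤ z + y
  +-monoʳ-≤ {x} {y} z x≤y = begin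
    z + x ≈⟨ +-comm z x ⟩
    x + z ≤⟨ +-monoˡ-≤ z x≤y ⟩
    y + z ≈⟨ +-comm y z ⟩
    z + y ∎

  +-mono-≤ : x ≤ y → u ≤ v → x + u ≤ y + v
  +-mono-≤ {y = y} {u} x≤y u≤v = ≤-trans (+-monoˡ-≤ u x≤y) (+-monoʳ-≤ y u≤v)

  x≤y⇒0≤y-x : x ≤ y → 0# ≤ y - x
  x≤y⇒0≤y-x {x} {y} x≤y = +-cancelʳ-≤ x (begin
    0# + x     ≈⟨ +-identityˡ x ⟩
    x          ≤⟨ x≤y ⟩
    y          ≈⟨ //-rightDividesˡ x y ⟨
    y - x + x  ∎)

  x<y⇒0<y-x : x < y → 0# < y - x
  x<y⇒0<y-x {x} {y} x<y = +-cancelʳ-< x (begin-strict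
    0# + x     ≈⟨ +-identityˡ x ⟩
    x          <⟨ x<y ⟩
    y          ≈⟨ //-rightDividesˡ x y ⟨
    y - x + x  ∎)

  neg-antimono-≤ : x ≤ y → - y ≤ - x
  neg-antimono-≤ {x} {y} x≤y = +-cancelʳ-≤ y (begin
    - y + y  ≈⟨ -‿inverseˡ y ⟩
    0#       ≤⟨ x≤y⇒0≤y-x x≤y ⟩
    y - x    ≈⟨ +-comm y (- x) ⟩
    - x + y  ∎)

  -- Signs cannot be decided, so `x * y < 0#` is refuted: it excludes that both factors are
  -- positive. If `x` were positive, `y` would be zero by tightness and so would the product; hence
  -- `x` is zero, and again so is the product.
  *-nonNeg : 0# ≤ x → 0# ≤ y → 0# ≤ x * y
  *-nonNeg {x} {y} 0≤x 0≤y xy<0 = <-irrefl xy≈0 xy<0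
    where
    y-pos-absurd : 0# < x → ¬ (0# < y)
    y-pos-absurd 0<x 0<y = <-asym xy<0 (*-pos 0<x 0<y)
    x≮0 : ¬ (0# < x)
    x≮0 0<x = <-irrefl (trans (*-congˡ (sym (≤∧≮⇒≈ 0≤y (y-pos-absurd 0<x)))) (zeroʳ x)) xy<0
    xy≈0 : x * y ≈ 0#
    xy≈0 = trans (*-congʳ (sym (≤∧≮⇒≈ 0≤x x≮0))) (zeroˡ y)

  *-distribʳ-- : ∀ x y z → (y - z) * x ≈ y * x - z * x
  *-distribʳ-- x y z = trans (distribʳ x y (- z)) (+-congˡ (sym (-‿distribˡ-* z x)))

  *-monoˡ-≤ : ∀ {z} → 0# ≤ z → x ≤ y → x * z ≤ y * z
  *-monoˡ-≤ {x} {y} {z} 0≤z x≤y = begin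
    x * z                     ≈⟨ +-identityˡ _ ⟨
    0# + x * z                ≤⟨ +-monoˡ-≤ (x * z) (*-nonNeg (x≤y⇒0≤y-x x≤y) 0≤z) ⟩
    (y - x) * z + x * z       ≈⟨ +-congʳ (*-distribʳ-- z y x) ⟩
    y * z - x * z + x * z     ≈⟨ //-rightDividesˡ (x * z) (y * z) ⟩
    y * z                     ∎

  *-monoˡ-< : ∀ {z} → 0# < z → x < y → x * z < y * z
  *-monoˡ-< {x} {y} {z} 0<z x<y = begin-strict
    x * z                     ≈⟨ +-identityˡ _ ⟨
    0# + x * z                <⟨ +-monoˡ-< (x * z) (*-pos (x<y⇒0<y-x x<y) 0<z) ⟩
    (y - x) * z + x * z       ≈⟨ +-congʳ (*-distribʳ-- z y x) ⟩
    y * z - x * z + x * z     ≈⟨ //-rightDividesˡ (x * z) (y * z) ⟩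
    y * z                     ∎

  *-monoʳ-≤ : ∀ {z} → 0# ≤ z → x ≤ y → z * x ≤ z * y
  *-monoʳ-≤ {x} {y} {z} 0≤z x≤y = begin
    z * x ≈⟨ *-comm z x ⟩
    x * z ≤⟨ *-monoˡ-≤ 0≤z x≤y ⟩
    y * z ≈⟨ *-comm y z ⟩
    z * y ∎

  *-cancelʳ-≤ : 0# < z → x * z ≤ y * z → x ≤ y
  *-cancelʳ-≤ 0<z le y<x = le (*-monoˡ-< 0<z y<x)

  ^-nonNeg : ∀ k → 0# ≤ x → 0# ≤ x ^ k
  ^-nonNeg zero    0≤x = <⇒≤ 0<1
  ^-nonNeg (suc k) 0≤x = *-nonNeg 0≤x (^-nonNeg k 0≤x)

  ^-pos : ∀ k → 0# < x → 0# < x ^ k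
  ^-pos zero    0<x = 0<1
  ^-pos (suc k) 0<x = *-pos 0<x (^-pos k 0<x)

  ^-≤1 : ∀ k → x ∈[0,1] → x ^ k ≤ 1#
  ^-≤1 zero    _ = ≤-refl
  ^-≤1 {x} (suc k) x∈@(0≤x , x≤1) = begin
    x * x ^ k ≤⟨ *-monoʳ-≤ 0≤x (^-≤1 k x∈) ⟩
    x * 1#    ≈⟨ *-identityʳ x ⟩
    x         ≤⟨ x≤1 ⟩
    1#        ∎

  ^-antimono-≤ : ∀ {m k} → x ∈[0,1] → m ℕ.≤ k → x ^ k ≤ x ^ m
  ^-antimono-≤ {k = k} x∈ z≤n       = ^-≤1 k x∈
  ^-antimono-≤         x∈ (s≤s m≤k) = *-monoʳ-≤ (proj₁ x∈) (^-antimono-≤ x∈ m≤k)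

  ^-mono-< : ∀ k .{{_ : NonZero k}} → 0# ≤ x → x < y → x ^ k < y ^ k
  ^-mono-< {x} {y} 1 0≤x x<y = begin-strict
    x * 1# ≈⟨ *-identityʳ x ⟩
    x      <⟨ x<y ⟩
    y      ≈⟨ *-identityʳ y ⟨
    y * 1# ∎
  ^-mono-< {x} {y} (suc k@(suc _)) 0≤x x<y = begin-strict
    -- `x` may be zero, so this step is only weak; strictness comes from the next one, where `y ^ k`
    -- is positive.
    x * x ^ k ≤⟨ *-monoʳ-≤ 0≤x (<⇒≤ (^-mono-< k 0≤x x<y)) ⟩
    x * y ^ k <⟨ *-monoˡ-< (^-pos k (≤-<-trans 0≤x x<y)) x<y ⟩
    y * y ^ k ∎

  /-cancel : ∀ x (y#0 : y # 0#) → x / y ⟨ y#0 ⟩ * y ≈ x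
  /-cancel {y} x y#0 with #⇒invertible y#0
  ... | y⁻¹ , y⁻¹*y≈1 , _ =
    trans (*-assoc x y⁻¹ y)
      (trans (*-congˡ (trans (*-congˡ (sym (x-0≈x y))) y⁻¹*y≈1)) (*-identityʳ x))

  x*v≤u*y⇒x/y≤u/v : (y#0 : y # 0#) (v#0 : v # 0#) → 0# < y → 0# < v →
    x * v ≤ u * y → x / y ⟨ y#0 ⟩ ≤ u / v ⟨ v#0 ⟩
  x*v≤u*y⇒x/y≤u/v {y} {v} {x} {u} y#0 v#0 0<y 0<v le = *-cancelʳ-≤ (*-pos 0<y 0<v) (begin
    x / y ⟨ y#0 ⟩ * (y * v) ≈⟨ *-assoc _ y v ⟨
    x / y ⟨ y#0 ⟩ * y * v   ≈⟨ *-congʳ (/-cancel x y#0) ⟩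
    x * v                   ≤⟨ le ⟩
    u * y                   ≈⟨ *-congʳ (/-cancel u v#0) ⟨
    u / v ⟨ v#0 ⟩ * v * y   ≈⟨ xy∙z≈xz∙y _ v y ⟩
    u / v ⟨ v#0 ⟩ * y * v   ≈⟨ *-assoc _ y v ⟩
    u / v ⟨ v#0 ⟩ * (y * v) ∎)

  2*½≈1 : 2# * ½ ≈ 1#
  2*½≈1 = trans (*-comm 2# ½) (/-cancel 1# 2#0)

  0<2 : 0# < 2#
  0<2 = begin-strict
    0#      <⟨ 0<1 ⟩
    1#      ≈⟨ +-identityˡ 1# ⟨
    0# + 1# <⟨ +-monoˡ-< 1# 0<1 ⟩
    2#      ∎

  1-x+x≈1 : ∀ x → 1# - x + x ≈ 1#
  1-x+x≈1 x = //-rightDividesˡ x 1#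

  ∈[0,1]⇒0≤1-x : x ∈[0,1] → 0# ≤ 1# - x
  ∈[0,1]⇒0≤1-x (_ , x≤1) = x≤y⇒0≤y-x x≤1

  convex-idem : ∀ p x → (1# - p) * x + p * x ≈ x
  convex-idem p x = trans (sym (distribʳ x (1# - p) p)) (trans (*-congʳ (1-x+x≈1 p)) (*-identityˡ x))

  convex-mono : p ∈[0,1] → x ≤ y → u ≤ v → (1# - p) * x + p * u ≤ (1# - p) * y + p * v
  convex-mono p∈ x≤y u≤v =
    +-mono-≤ (*-monoʳ-≤ (∈[0,1]⇒0≤1-x p∈) x≤y) (*-monoʳ-≤ (proj₁ p∈) u≤v)

  -- Supplies the thinning probability `t` that turns a `q`-random subset into a `p`-random one.
  scale-factor : 0# ≤ p → p ≤ q → 0# < q → ∃[ t ] t ∈[0,1] × t * q ≈ p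
  scale-factor {p} {q} 0≤p p≤q 0<q = t , (0≤t , t≤1) , t*q≈p
    where
    q#0 : q # 0#
    q#0 = Equivalence.from #⇔<⊎> (inj₂ 0<q)
    t : Carrier
    t = p / q ⟨ q#0 ⟩
    t*q≈p : t * q ≈ p
    t*q≈p = /-cancel p q#0
    0≤t : 0# ≤ t
    0≤t = *-cancelʳ-≤ 0<q (begin
      0# * q ≈⟨ zeroˡ q ⟩
      0#     ≤⟨ 0≤p ⟩
      p      ≈⟨ t*q≈p ⟨
      t * q  ∎)
    t≤1 : t ≤ 1#
    t≤1 = *-cancelʳ-≤ 0<q (begin
      t * q  ≈⟨ t*q≈p ⟩
      p      ≤⟨ p≤q ⟩
      q      ≈⟨ *-identityˡ q ⟨
      1# * q ∎)

-- Expectations over random subsets, and thinning by intersection.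

module Expectation {c ℓ₁ ℓ₂ ℓ₃} (ℝ : RealNumbers c ℓ₁ ℓ₂ ℓ₃) where

  open RealDefinitions ℝ
  open OrderedField ℝ

  private variable
    p q t : Carrier
    f g : Subset n → Carrier

  -- The expectation of f over p-random subsets.
  𝔼 : Carrier → (Subset n → Carrier) → Carrier
  𝔼 {zero}  p f = f Vec.[]
  𝔼 {suc n} p f = (1# - p) * 𝔼 p (f ∘ (outside Vec.∷_)) + p * 𝔼 p (f ∘ (inside Vec.∷_))

  𝔼-cong : p ≈ q → (∀ S → f S ≈ g S) → 𝔼 {n} p f ≈ 𝔼 q g
  𝔼-cong {n = zero}  p≈q f≈g = f≈g Vec.[]
  𝔼-cong {n = suc n} p≈q f≈g = +-cong
    (*-cong (+-congˡ (-‿cong p≈q)) (𝔼-cong p≈q (f≈g ∘ (outside Vec.∷_))))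
    (*-cong p≈q (𝔼-cong p≈q (f≈g ∘ (inside Vec.∷_))))

  𝔼-mono : p ∈[0,1] → (∀ S → f S ≤ g S) → 𝔼 {n} p f ≤ 𝔼 p g
  𝔼-mono {n = zero}  p∈ f≤g = f≤g Vec.[]
  𝔼-mono {n = suc n} p∈ f≤g = convex-mono p∈
    (𝔼-mono p∈ (f≤g ∘ (outside Vec.∷_))) (𝔼-mono p∈ (f≤g ∘ (inside Vec.∷_)))

  𝔼-const : ∀ n p x → 𝔼 {n} p (λ _ → x) ≈ x
  𝔼-const zero    p x = refl
  𝔼-const (suc n) p x =
    trans (+-cong (*-congˡ (𝔼-const n p x)) (*-congˡ (𝔼-const n p x))) (convex-idem p x)

  𝔼-+ : ∀ n {f g : Subset n → Carrier} → 𝔼 p (λ S → f S + g S) ≈ 𝔼 p f + 𝔼 p g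
  𝔼-+ zero = refl
  𝔼-+ {p} (suc n) {f} {g} = begin
    s * 𝔼 p (λ S → f₀ S + g₀ S) + p * 𝔼 p (λ S → f₁ S + g₁ S)
      ≈⟨ +-cong (trans (*-congˡ (𝔼-+ n)) (distribˡ s _ _))
                (trans (*-congˡ (𝔼-+ n)) (distribˡ p _ _)) ⟩
    s * 𝔼 p f₀ + s * 𝔼 p g₀ + (p * 𝔼 p f₁ + p * 𝔼 p g₁)
      ≈⟨ interchange _ _ _ _ ⟩
    s * 𝔼 p f₀ + p * 𝔼 p f₁ + (s * 𝔼 p g₀ + p * 𝔼 p g₁) ∎
    where
    open SetoidReasoning setoid
    s = 1# - p
    f₀ f₁ g₀ g₁ : Subset n → Carrier
    f₀ = f ∘ (outside Vec.∷_)
    f₁ = f ∘ (inside Vec.∷_)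
    g₀ = g ∘ (outside Vec.∷_)
    g₁ = g ∘ (inside Vec.∷_)

  𝔼-* : ∀ n {f : Subset n → Carrier} x → 𝔼 p (λ S → x * f S) ≈ x * 𝔼 p f
  𝔼-* zero    x = refl
  𝔼-* {p} (suc n) x = trans
    (+-cong (trans (*-congˡ (𝔼-* n x)) (x∙yz≈y∙xz (1# - p) x _))
            (trans (*-congˡ (𝔼-* n x)) (x∙yz≈y∙xz p x _)))
    (sym (distribˡ x _ _))

  -- Induction on the ground set: the first element lies in `S ∩ T` with probability `t * q`,
  -- independently of the rest.
  thinning : ∀ t q (f : Subset n → Carrier) →
    𝔼 q (λ S → 𝔼 t (λ T → f (S ∩ T))) ≈ 𝔼 (t * q) f
  thinning {n = zero}  t q f = refl
  thinning {n = suc n} t q f = begin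
    (1# - q) * 𝔼 q (λ S → (1# - t) * 𝔼 t (λ T → f₀ (S ∩ T)) + t * 𝔼 t (λ T → f₀ (S ∩ T)))
      + q * 𝔼 q (λ S → (1# - t) * 𝔼 t (λ T → f₀ (S ∩ T)) + t * 𝔼 t (λ T → f₁ (S ∩ T)))
      -- If `S` omits the first element, the choice of `T` there is irrelevant and its two branches
      -- merge. If `S` contains it, linearity separates the two choices of `T`.
      ≈⟨ +-cong (*-congˡ (𝔼-cong {n = n} refl λ S → convex-idem t _))
                (*-congˡ (trans (𝔼-+ n) (+-cong (𝔼-* n (1# - t)) (𝔼-* n t)))) ⟩
    (1# - q) * 𝔼 q (λ S → 𝔼 t (λ T → f₀ (S ∩ T)))
      + q * ((1# - t) * 𝔼 q (λ S → 𝔼 t (λ T → f₀ (S ∩ T))) + t * 𝔼 q (λ S → 𝔼 t (λ T → f₁ (S ∩ T))))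
      ≈⟨ +-cong (*-congˡ X) (*-congˡ (+-cong (*-congˡ X) (*-congˡ Y))) ⟩
    (1# - q) * x + q * ((1# - t) * x + t * y)
      ≈⟨ +-congˡ (trans (distribˡ q _ _) (+-cong (sym (*-assoc q (1# - t) x)) (sym (*-assoc q t y)))) ⟩
    (1# - q) * x + (q * (1# - t) * x + q * t * y)
      ≈⟨ +-assoc _ _ _ ⟨
    (1# - q) * x + q * (1# - t) * x + q * t * y
      ≈⟨ +-cong (trans (sym (distribʳ x _ _)) (*-congʳ outside-weight)) (*-congʳ (*-comm q t)) ⟩
    (1# - t * q) * x + t * q * y ∎
    where
    open SetoidReasoning setoid
    f₀ f₁ : Subset n → Carrier
    f₀ = f ∘ (outside Vec.∷_)
    f₁ = f ∘ (inside Vec.∷_)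
    x = 𝔼 (t * q) f₀
    y = 𝔼 (t * q) f₁
    X = thinning t q f₀
    Y = thinning t q f₁
    -- The first element is lost either because `S` omits it or because `S` has it and `T` drops it.
    outside-weight : 1# - q + q * (1# - t) ≈ 1# - t * q
    outside-weight = begin
      1# - q + q * (1# - t)       ≈⟨ +-congˡ (*-comm q (1# - t)) ⟩
      1# - q + (1# - t) * q       ≈⟨ +-congˡ (*-distribʳ-- q 1# t) ⟩
      1# - q + (1# * q - t * q)   ≈⟨ +-congˡ (+-congʳ (*-identityˡ q)) ⟩
      1# - q + (q - t * q)        ≈⟨ +-assoc _ q _ ⟨
      1# - q + q - t * q          ≈⟨ +-congʳ (1-x+x≈1 q) ⟩
      1# - t * q                  ∎

  -- Bounds on an expectation from its values on particular sets.

  open ≤-Reasoning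

  -- `f` dominates the indicator of the event `M ⊆ T`, which has probability `t ^ ∣ M ∣`: each
  -- element of `M` costs a factor `t`, and other elements only average two equal bounds.
  𝔼-≥-superset : ∀ {n t} {f : Subset n → Carrier} → t ∈[0,1] → (M : Subset n) →
    (∀ T → 0# ≤ f T) → (∀ T → M ⊆ T → 1# ≤ f T) → t ^ ∣ M ∣ ≤ 𝔼 t f
  𝔼-≥-superset t∈ Vec.[] 0≤f 1≤f = 1≤f Vec.[] ⊆-refl
  𝔼-≥-superset {suc n} {t} {f} t∈ (outside Vec.∷ M) 0≤f 1≤f = begin
    t ^ ∣ M ∣                                  ≈⟨ convex-idem t _ ⟨
    (1# - t) * t ^ ∣ M ∣ + t * t ^ ∣ M ∣       ≤⟨ convex-mono t∈ (ih outside) (ih inside) ⟩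
    𝔼 t f                                      ∎
    where
    ih : ∀ s → t ^ ∣ M ∣ ≤ 𝔼 t (f ∘ (s Vec.∷_))
    ih s = 𝔼-≥-superset t∈ M (0≤f ∘ (s Vec.∷_)) λ T M⊆T → 1≤f (s Vec.∷ T) (out⊆ M⊆T)
  𝔼-≥-superset {suc n} {t} {f} t∈ (inside Vec.∷ M) 0≤f 1≤f = begin
    t * t ^ ∣ M ∣                              ≈⟨ +-identityˡ _ ⟨
    0# + t * t ^ ∣ M ∣                         ≈⟨ +-congʳ (zeroʳ (1# - t)) ⟨
    (1# - t) * 0# + t * t ^ ∣ M ∣              ≤⟨ convex-mono t∈ 0≤𝔼f₀ ih ⟩
    𝔼 t f                                      ∎
    where
    0≤𝔼f₀ : 0# ≤ 𝔼 t (f ∘ (outside Vec.∷_))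
    0≤𝔼f₀ = begin
      0#               ≈⟨ 𝔼-const n t 0# ⟨
      𝔼 {n} t (λ _ → 0#)   ≤⟨ 𝔼-mono t∈ (0≤f ∘ (outside Vec.∷_)) ⟩
      𝔼 t (f ∘ (outside Vec.∷_)) ∎
    ih : t ^ ∣ M ∣ ≤ 𝔼 t (f ∘ (inside Vec.∷_))
    ih = 𝔼-≥-superset t∈ M (0≤f ∘ (inside Vec.∷_)) λ T M⊆T → 1≤f (inside Vec.∷ T) (s⊆s M⊆T)

  -- `f` is dominated by the indicator of `T` being nonempty, and `T` is empty with probability
  -- `(1# - t) ^ n`. In the induction only the branch omitting the first element can still lead to
  -- `⊥`; the other is bounded by 1.
  𝔼-≤-nonempty : ∀ {n t} {f : Subset n → Carrier} → t ∈[0,1] →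
    f ⊥ ≤ 0# → (∀ T → f T ≤ 1#) → 𝔼 t f ≤ 1# - (1# - t) ^ n
  𝔼-≤-nonempty {zero} {f = f} t∈ f⊥≤0 f≤1 = begin
    f Vec.[] ≤⟨ f⊥≤0 ⟩
    0#       ≈⟨ -‿inverseʳ 1# ⟨
    1# - 1#  ∎
  𝔼-≤-nonempty {suc n} {t} {f} t∈ f⊥≤0 f≤1 = begin
    𝔼 t f                                ≤⟨ convex-mono t∈ ih 𝔼f₁≤1 ⟩
    s * (1# - s ^ n) + t * 1#
      ≈⟨ +-cong (trans (*-comm s _) (*-distribʳ-- s 1# (s ^ n))) (*-identityʳ t) ⟩
    1# * s - s ^ n * s + t               ≈⟨ +-congʳ (+-cong (*-identityˡ s) (-‿cong (*-comm _ s))) ⟩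
    s - s * s ^ n + t                    ≈⟨ +-assoc s _ t ⟩
    s + (- (s * s ^ n) + t)              ≈⟨ +-congˡ (+-comm _ t) ⟩
    s + (t - s * s ^ n)                  ≈⟨ +-assoc s t _ ⟨
    s + t - s * s ^ n                    ≈⟨ +-congʳ (1-x+x≈1 t) ⟩
    1# - s * s ^ n                       ∎
    where
    s = 1# - t
    ih : 𝔼 t (f ∘ (outside Vec.∷_)) ≤ 1# - s ^ n
    ih = 𝔼-≤-nonempty t∈ f⊥≤0 (f≤1 ∘ (outside Vec.∷_))
    𝔼f₁≤1 : 𝔼 t (f ∘ (inside Vec.∷_)) ≤ 1#
    𝔼f₁≤1 = begin
      𝔼 t (f ∘ (inside Vec.∷_)) ≤⟨ 𝔼-mono t∈ (f≤1 ∘ (inside Vec.∷_)) ⟩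
      𝔼 {n} t (λ _ → 1#)        ≈⟨ 𝔼-const n t 1# ⟩
      1#                        ∎

  -- As a polynomial in `p`, the expectation has constant term `f ⊥`; when that vanishes, a factor
  -- `p` splits off.
  𝔼-divisible : ∀ n p {f : Subset n → Carrier} → f ⊥ ≈ 0# → ∃[ x ] 𝔼 p f ≈ p * x
  𝔼-divisible zero    p f⊥≈0 = 0# , trans f⊥≈0 (sym (zeroʳ p))
  𝔼-divisible (suc n) p f⊥≈0 with 𝔼-divisible n p f⊥≈0
  ... | x , 𝔼f₀≈p*x = _ ,
    trans (+-congʳ (trans (*-congˡ 𝔼f₀≈p*x) (x∙yz≈y∙xz (1# - p) p x))) (sym (distribˡ p _ _))

  -- From weighted sums over the list of subsets to expectations.

  sum-++ : ∀ xs ys → sum (xs ++ ys) ≈ sum xs + sum ys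
  sum-++ []       ys = sym (+-identityˡ _)
  sum-++ (x ∷ xs) ys = trans (+-congˡ (sum-++ xs ys)) (sym (+-assoc x _ _))

  sum-scale : ∀ {A : Set} (f g : A → Carrier) x → (∀ y → f y ≈ x * g y) →
    ∀ ys → sum (map f ys) ≈ x * sum (map g ys)
  sum-scale f g x f≈x*g []       = sym (zeroʳ x)
  sum-scale f g x f≈x*g (y ∷ ys) =
    trans (+-cong (f≈x*g y) (sum-scale f g x f≈x*g ys)) (sym (distribˡ x _ _))

  sum-weight≈𝔼 : ∀ p (f : Subset n → Carrier) →
    sum (map (λ S → weight p S * f S) (subsets n)) ≈ 𝔼 p f
  sum-weight≈𝔼 {n = zero}  p f = trans (+-identityʳ _) (*-identityˡ _)
  sum-weight≈𝔼 {n = suc n} p f = begin-equality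
    sum (map w (map (outside Vec.∷_) (subsets n) ++ map (inside Vec.∷_) (subsets n)))
      ≡⟨ ≡.cong sum (map-++ w (map (outside Vec.∷_) (subsets n)) _) ⟩
    sum (map w (map (outside Vec.∷_) (subsets n)) ++ map w (map (inside Vec.∷_) (subsets n)))
      ≈⟨ sum-++ (map w (map (outside Vec.∷_) (subsets n))) _ ⟩
    sum (map w (map (outside Vec.∷_) (subsets n))) + sum (map w (map (inside Vec.∷_) (subsets n)))
      ≈⟨ +-cong (half outside (1# - p) λ S → *-assoc _ _ _) (half inside p λ S → *-assoc _ _ _) ⟩
    𝔼 p f ∎
    where
    w : Subset (suc n) → Carrier
    w S = weight p S * f S
    half : ∀ s x → (∀ S → w (s Vec.∷ S) ≈ x * (weight p S * f (s Vec.∷ S))) →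
      sum (map w (map (s Vec.∷_) (subsets n))) ≈ x * 𝔼 p (f ∘ (s Vec.∷_))
    half s x w≈ = begin-equality
      sum (map w (map (s Vec.∷_) (subsets n))) ≡⟨ ≡.cong sum (map-∘ (subsets n)) ⟨
      sum (map (w ∘ (s Vec.∷_)) (subsets n))   ≈⟨ sum-scale _ _ x w≈ (subsets n) ⟩
      x * sum (map (λ S → weight p S * f (s Vec.∷ S)) (subsets n))
        ≈⟨ *-congˡ (sum-weight≈𝔼 p (f ∘ (s Vec.∷_))) ⟩
      x * 𝔼 p (f ∘ (s Vec.∷_)) ∎

  -- `μ` as the expectation of an indicator, and its behaviour under thinning.

  module _ {𝒜 : Family a n} (𝒜? : Decidable 𝒜) where

    -- Branching on `does` matches `filter`, so both reduce together in `sum-filter`.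
    indicator : Subset n → Carrier
    indicator S = if does (𝒜? S) then 1# else 0#

    indicator-∈ : ∀ {S} → 𝒜 S → indicator S ≈ 1#
    indicator-∈ {S} S∈𝒜 with 𝒜? S
    ... | yes _   = refl
    ... | no  S∉𝒜 = contradiction S∈𝒜 S∉𝒜

    indicator-∉ : ∀ {S} → ¬ 𝒜 S → indicator S ≈ 0#
    indicator-∉ {S} S∉𝒜 with 𝒜? S
    ... | yes S∈𝒜 = contradiction S∈𝒜 S∉𝒜
    ... | no  _   = refl

    0≤indicator : ∀ S → 0# ≤ indicator S
    0≤indicator S with does (𝒜? S)
    ... | true  = <⇒≤ 0<1
    ... | false = ≤-refl

    indicator≤1 : ∀ S → indicator S ≤ 1#
    indicator≤1 S with does (𝒜? S)
    ... | true  = ≤-refl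
    ... | false = <⇒≤ 0<1

    sum-filter : ∀ (w : Subset n → Carrier) Ss →
      sum (map w (filter 𝒜? Ss)) ≈ sum (map (λ S → w S * indicator S) Ss)
    sum-filter w []       = refl
    sum-filter w (S ∷ Ss) with does (𝒜? S)
    ... | true  = +-cong (sym (*-identityʳ (w S))) (sum-filter w Ss)
    ... | false = trans (sum-filter w Ss) (sym (trans (+-congʳ (zeroʳ (w S))) (+-identityˡ _)))

    μ≈𝔼 : ∀ p → μ 𝒜? p ≈ 𝔼 p indicator
    μ≈𝔼 p = trans (sum-filter (weight p) (subsets n)) (sum-weight≈𝔼 p indicator)

    μ-cong : p ≈ q → μ 𝒜? p ≈ μ 𝒜? q
    μ-cong {p} {q} p≈q = trans (μ≈𝔼 p) (trans (𝔼-cong {n = n} p≈q (λ _ → refl)) (sym (μ≈𝔼 q)))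

    μ-thinning : ∀ t q → 𝔼 q (λ S → 𝔼 t (λ T → indicator (S ∩ T))) ≈ μ 𝒜? (t * q)
    μ-thinning t q = trans (thinning t q indicator) (sym (μ≈𝔼 (t * q)))

    x*μ≈𝔼 : ∀ x q → x * μ 𝒜? q ≈ 𝔼 q (λ S → x * indicator S)
    x*μ≈𝔼 x q = trans (*-congˡ (μ≈𝔼 q)) (sym (𝔼-* n x))

    -- The inequality already holds conditionally on each fixed `S`; averaging over `q`-random `S`
    -- gives the claim.
    μ-thin-≥ : ∀ {k} → Monotone 𝒜 → (∀ M → IsMinterm 𝒜 M → ∣ M ∣ ℕ.≤ k) →
      t ∈[0,1] → q ∈[0,1] → t ^ k * μ 𝒜? q ≤ μ 𝒜? (t * q)
    μ-thin-≥ {t} {q} {k} mono small t∈ q∈ = begin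
      t ^ k * μ 𝒜? q                                   ≈⟨ x*μ≈𝔼 (t ^ k) q ⟩
      𝔼 q (λ S → t ^ k * indicator S)                  ≤⟨ 𝔼-mono q∈ pointwise ⟩
      𝔼 q (λ S → 𝔼 t (λ T → indicator (S ∩ T)))        ≈⟨ μ-thinning t q ⟩
      μ 𝒜? (t * q)                                     ∎
      where
      survival : ∀ {S} → 𝒜 S → t ^ k ≤ 𝔼 t (λ T → indicator (S ∩ T))
      survival {S} S∈𝒜 with minterm-below 𝒜? S S∈𝒜
      -- Whenever `M ⊆ T`, also `M ⊆ S ∩ T`, so `S ∩ T` is in `𝒜`. Since `t` is at most 1, the bound
      -- `∣ M ∣ ≤ k` lets `t ^ k` replace `t ^ ∣ M ∣`.
      ... | M , minM@(M∈𝒜 , _) , M⊆S = ≤-trans (^-antimono-≤ t∈ (small M minM))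
        (𝔼-≥-superset t∈ M (λ T → 0≤indicator (S ∩ T))
          λ T M⊆T → ≈⇒≤ (sym (indicator-∈ (mono M∈𝒜 λ x∈M → x∈p∩q⁺ (M⊆S x∈M , M⊆T x∈M)))))

      pointwise : ∀ S → t ^ k * indicator S ≤ 𝔼 t (λ T → indicator (S ∩ T))
      pointwise S with 𝒜? S
      ... | yes S∈𝒜 = ≤-trans (≈⇒≤ (*-identityʳ (t ^ k))) (survival S∈𝒜)
      ... | no  _   = begin
        t ^ k * 0#                      ≈⟨ zeroʳ (t ^ k) ⟩
        0#                              ≈⟨ 𝔼-const n t 0# ⟨
        𝔼 {n} t (λ _ → 0#)                  ≤⟨ 𝔼-mono t∈ (λ T → 0≤indicator (S ∩ T)) ⟩
        𝔼 t (λ T → indicator (S ∩ T))   ∎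

    -- Again for each fixed `S`: a member is destroyed at least when `T` is empty, and a non-member
    -- cannot enter `𝒜` by shrinking.
    μ-thin-≤ : Monotone 𝒜 → ¬ 𝒜 ⊥ → t ∈[0,1] → q ∈[0,1] →
      μ 𝒜? (t * q) ≤ (1# - (1# - t) ^ n) * μ 𝒜? q
    μ-thin-≤ {t} {q} mono ⊥∉𝒜 t∈ q∈ = begin
      μ 𝒜? (t * q)                                     ≈⟨ μ-thinning t q ⟨
      𝔼 q (λ S → 𝔼 t (λ T → indicator (S ∩ T)))        ≤⟨ 𝔼-mono q∈ pointwise ⟩
      𝔼 q (λ S → d * indicator S)                      ≈⟨ x*μ≈𝔼 d q ⟨
      d * μ 𝒜? q                                       ∎
      where
      d = 1# - (1# - t) ^ n
      pointwise : ∀ S → 𝔼 t (λ T → indicator (S ∩ T)) ≤ d * indicator S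
      pointwise S with 𝒜? S
      ... | yes _ = ≤-trans
        (𝔼-≤-nonempty t∈ (≈⇒≤ (indicator-∉ λ S∩⊥∈𝒜 → ⊥∉𝒜 (mono S∩⊥∈𝒜 (p∩q⊆q S ⊥))))
                      (λ T → indicator≤1 (S ∩ T)))
        (≈⇒≤ (sym (*-identityʳ d)))
      ... | no S∉𝒜 = ≈⇒≤ (trans
        (𝔼-cong refl λ T → indicator-∉ λ S∩T∈𝒜 → S∉𝒜 (mono S∩T∈𝒜 (p∩q⊆p S T)))
        (trans (𝔼-const n t 0#) (sym (zeroʳ d))))

    -- The ratio inequality with denominators cleared, so that `p` may be zero; the bound on `δ`
    -- applies it to `pε`, not known there to be apart from zero.
    μ-cross-≤ : ∀ {k} → Monotone 𝒜 → (∀ M → IsMinterm 𝒜 M → ∣ M ∣ ℕ.≤ k) →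
      0# ≤ p → p ≤ q → 0# < q → q ≤ 1# → μ 𝒜? q * p ^ k ≤ μ 𝒜? p * q ^ k
    μ-cross-≤ {p} {q} {k} mono small 0≤p p≤q 0<q q≤1 with scale-factor 0≤p p≤q 0<q
    ... | t , t∈ , t*q≈p = begin
      μ 𝒜? q * p ^ k             ≈⟨ *-congˡ (^-congˡ k t*q≈p) ⟨
      μ 𝒜? q * (t * q) ^ k       ≈⟨ *-congˡ (^-distrib-* t q k) ⟩
      μ 𝒜? q * (t ^ k * q ^ k)   ≈⟨ *-assoc _ _ _ ⟨
      μ 𝒜? q * t ^ k * q ^ k     ≈⟨ *-congʳ (*-comm _ (t ^ k)) ⟩
      t ^ k * μ 𝒜? q * q ^ k     ≤⟨ *-monoˡ-≤ (^-nonNeg k (<⇒≤ 0<q)) (μ-thin-≥ mono small t∈ (<⇒≤ 0<q , q≤1)) ⟩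
      μ 𝒜? (t * q) * q ^ k       ≈⟨ *-congʳ (μ-cong t*q≈p) ⟩
      μ 𝒜? p * q ^ k             ∎

    -- Assuming `p < q`, write `p` as `t * q`. If `t < 1#`, then `(1# - t) ^ n` is positive and `μ`
    -- drops strictly, a contradiction; so `t` equals 1 by tightness and `p` equals `q`, which is
    -- absurd.
    μ-reflects-≤ : Monotone 𝒜 → ¬ 𝒜 ⊥ → p ∈[0,1] → q ∈[0,1] →
      0# < μ 𝒜? q → μ 𝒜? q ≤ μ 𝒜? p → q ≤ p
    μ-reflects-≤ {p} {q} mono ⊥∉𝒜 (0≤p , _) q∈ 0<μq μq≤μp p<q
      with scale-factor 0≤p (<⇒≤ p<q) (≤-<-trans 0≤p p<q)
    ... | t , t∈@(_ , t≤1) , t*q≈p = <-irrefl p≈q p<q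
      where
      t≮1 : ¬ (t < 1#)
      t≮1 t<1 = μq≤μp (begin-strict
        μ 𝒜? p                            ≈⟨ μ-cong t*q≈p ⟨
        μ 𝒜? (t * q)                      ≤⟨ μ-thin-≤ mono ⊥∉𝒜 t∈ q∈ ⟩
        (1# - (1# - t) ^ n) * μ 𝒜? q      <⟨ *-monoˡ-< 0<μq d<1 ⟩
        1# * μ 𝒜? q                       ≈⟨ *-identityˡ _ ⟩
        μ 𝒜? q                            ∎)
        where
        d<1 : 1# - (1# - t) ^ n < 1#
        d<1 = +-cancelʳ-< ((1# - t) ^ n) (begin-strict
          1# - (1# - t) ^ n + (1# - t) ^ n ≈⟨ 1-x+x≈1 _ ⟩
          1#                               ≈⟨ +-identityˡ 1# ⟨
          0# + 1#                          <⟨ +-monoˡ-< 1# (^-pos n (x<y⇒0<y-x t<1)) ⟩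
          (1# - t) ^ n + 1#                ≈⟨ +-comm _ 1# ⟩
          1# + (1# - t) ^ n                ∎)
      p≈q : p ≈ q
      p≈q = trans (sym t*q≈p) (trans (*-congʳ (≤∧≮⇒≈ t≤1 t≮1)) (*-identityˡ q))

    -- `μ 𝒜? p` is a multiple of `p`, so an inverse of it yields an inverse of `p`.
    μ#0⇒#0 : ¬ 𝒜 ⊥ → μ 𝒜? p # 0# → p # 0#
    μ#0⇒#0 {p} ⊥∉𝒜 μp#0 with 𝔼-divisible n p (indicator-∉ ⊥∉𝒜)
    ... | x , 𝔼≈p*x with #⇒invertible μp#0
    ... | y , _ , [μp-0]*y≈1 = invertibleʳ⇒# (x * y , (begin-equality
      (p - 0#) * (x * y)   ≈⟨ *-congʳ (x-0≈x p) ⟩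
      p * (x * y)          ≈⟨ *-assoc p x y ⟨
      p * x * y            ≈⟨ *-congʳ (trans (μ≈𝔼 p) 𝔼≈p*x) ⟨
      μ 𝒜? p * y           ≈⟨ *-congʳ (x-0≈x _) ⟨
      (μ 𝒜? p - 0#) * y    ≈⟨ [μp-0]*y≈1 ⟩
      1#                   ∎))

-- The decreasing ratio and the resulting bound on `δ`.

theorem2p1 : ∀ {c ℓ₁ ℓ₂ ℓ₃ a} (ℝ : RealNumbers c ℓ₁ ℓ₂ ℓ₃) → let open RealDefinitions ℝ in
    (n k : ℕ) .{{_ : NonZero k}}
    (𝒜 : Family a (suc n)) (𝒜? : Decidable 𝒜) →
    Monotone 𝒜 →
    (∀ M → IsMinterm 𝒜 M → ∣ M ∣ ℕ.≤ k) →
    (∀ p q (p#0 : p # 0#) (q#0 : q # 0#) →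
    p ∈[0,1] → q ∈[0,1] → p ≤ q →
    (μ 𝒜? q / q ^ k ⟨ ^-#0 k q#0 ⟩) ≤ (μ 𝒜? p / p ^ k ⟨ ^-#0 k p#0 ⟩))
    ×
    (NonTrivial 𝒜 →
    ∀ ε → 0# < ε → ε ≤ ½ →
    ∀ p½ pε → IsCritical 𝒜? ½ p½ → IsCritical 𝒜? ε pε →
    ∀ r → IsRoot k (2# * ε) r →
    Σ[ p½#0 ∈ p½ # 0# ] (1# - r) ≤ δ p½ pε p½#0)
theorem2p1 ℝ n k 𝒜 𝒜? mono small = ratio-antimono , δ-bound
  where
  open RealDefinitions ℝ
  open OrderedField ℝ
  open Expectation ℝ
  open ≤-Reasoning

  ratio-antimono : ∀ p q (p#0 : p # 0#) (q#0 : q # 0#) → p ∈[0,1] → q ∈[0,1] → p ≤ q →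
    (μ 𝒜? q / q ^ k ⟨ ^-#0 k q#0 ⟩) ≤ (μ 𝒜? p / p ^ k ⟨ ^-#0 k p#0 ⟩)
  ratio-antimono p q p#0 q#0 (0≤p , _) (0≤q , q≤1) p≤q =
    x*v≤u*y⇒x/y≤u/v (^-#0 k q#0) (^-#0 k p#0) (^-pos k 0<q) (^-pos k (≤∧#⇒< 0≤p p#0))
      (μ-cross-≤ 𝒜? mono small 0≤p p≤q 0<q q≤1)
    where
    0<q : 0# < q
    0<q = ≤∧#⇒< 0≤q q#0

  δ-bound : NonTrivial 𝒜 → ∀ ε → 0# < ε → ε ≤ ½ →
    ∀ p½ pε → IsCritical 𝒜? ½ p½ → IsCritical 𝒜? ε pε →
    ∀ r → IsRoot k (2# * ε) r → Σ[ p½#0 ∈ p½ # 0# ] (1# - r) ≤ δ p½ pε p½#0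
  δ-bound (_ , ¬universal) ε 0<ε ε≤½ p½ pε (p½∈@(0≤p½ , p½≤1) , μp½≈½) (pε∈@(0≤pε , _) , μpε≈ε)
          r (0≤r , r^k≈2ε) = p½#0 , 1-r≤δ
    where
    ⊥∉𝒜 : ¬ 𝒜 ⊥
    ⊥∉𝒜 ⊥∈𝒜 = ¬universal λ S → mono ⊥∈𝒜 (⊆-min S)

    0<μp½ : 0# < μ 𝒜? p½
    0<μp½ = begin-strict
      0#       <⟨ 0<ε ⟩
      ε        ≤⟨ ε≤½ ⟩
      ½        ≈⟨ μp½≈½ ⟨
      μ 𝒜? p½  ∎

    p½#0 : p½ # 0#
    p½#0 = μ#0⇒#0 𝒜? ⊥∉𝒜 (Equivalence.from #⇔<⊎> (inj₂ 0<μp½))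

    0<p½ : 0# < p½
    0<p½ = ≤∧#⇒< 0≤p½ p½#0

    pε≤p½ : pε ≤ p½
    -- The order of the two critical probabilities rests on `ε ≤ ½`; for larger `ε` it is reversed,
    -- and with it the comparison of `pε ^ k` with `2# * ε * p½ ^ k`.
    pε≤p½ = μ-reflects-≤ 𝒜? mono ⊥∉𝒜 p½∈ pε∈
      (<-respʳ-≈ (sym μpε≈ε) 0<ε)
      (begin
        μ 𝒜? pε  ≈⟨ μpε≈ε ⟩
        ε        ≤⟨ ε≤½ ⟩
        ½        ≈⟨ μp½≈½ ⟨
        μ 𝒜? p½  ∎)

    pε^k≤[r*p½]^k : pε ^ k ≤ (r * p½) ^ k
    -- The factor `2#` cancels `μ 𝒜? p½`, which is `½`; this is where `2# * ε` under the root comes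
    -- from.
    pε^k≤[r*p½]^k = begin
      pε ^ k                     ≈⟨ *-identityˡ _ ⟨
      1# * pε ^ k                ≈⟨ *-congʳ 2*½≈1 ⟨
      2# * ½ * pε ^ k            ≈⟨ *-assoc 2# ½ _ ⟩
      2# * (½ * pε ^ k)          ≈⟨ *-congˡ (*-congʳ μp½≈½) ⟨
      2# * (μ 𝒜? p½ * pε ^ k)    ≤⟨ *-monoʳ-≤ (<⇒≤ 0<2) (μ-cross-≤ 𝒜? mono small 0≤pε pε≤p½ 0<p½ p½≤1) ⟩
      2# * (μ 𝒜? pε * p½ ^ k)    ≈⟨ *-congˡ (*-congʳ μpε≈ε) ⟩
      2# * (ε * p½ ^ k)          ≈⟨ *-assoc 2# ε _ ⟨
      2# * ε * p½ ^ k            ≈⟨ *-congʳ r^k≈2ε ⟨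
      r ^ k * p½ ^ k             ≈⟨ ^-distrib-* r p½ k ⟨
      (r * p½) ^ k               ∎

    pε≤r*p½ : pε ≤ r * p½
    -- The `k`-th root is taken by contraposition, from strict monotonicity of powers for nonzero
    -- `k`.
    pε≤r*p½ r*p½<pε = pε^k≤[r*p½]^k (^-mono-< k (*-nonNeg 0≤r 0≤p½) r*p½<pε)

    1-r≤δ : 1# - r ≤ δ p½ pε p½#0
    1-r≤δ = *-cancelʳ-≤ 0<p½ (begin
      (1# - r) * p½           ≈⟨ *-distribʳ-- p½ 1# r ⟩
      1# * p½ - r * p½        ≈⟨ +-congʳ (*-identityˡ p½) ⟩
      p½ - r * p½             ≤⟨ +-monoʳ-≤ p½ (neg-antimono-≤ pε≤r*p½) ⟩
      p½ - pε                 ≈⟨ /-cancel (p½ - pε) p½#0 ⟨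
      δ p½ pε p½#0 * p½       ∎)
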